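{- Let $f$ be chosen uniformly at random from $F(n)$. The probability that there exists $h\in F(n)$ with $h\sim f$ such that $\mathcal{A}(h)$ has at least $0.046\cdot 2^n$ attractors, each of size at most $4$, tends to $1$ as $n\to\infty$.
   Context: $F(n)$ is the set of all functions $f:\{0,1\}^n\to\{0,1\}^n$, written $f=(f_1,\dots,f_n)$. $e_i$ is the configuration with a $1$ exactly in component $i$; addition is componentwise modulo $2$. The asynchronous graph $\mathcal{A}(f)$ is the digraph on $\{0,1\}^n$ with an arc from $x$ to $x+e_i$ whenever $f_i(x)\neq x_i$. An attractor is an inclusion-minimal non-empty set $X\subseteq\{0,1\}^n$ with no arc from $X$ to its complement. $\mathcal{S}(f)$ has an arc $x\to f(x)$ for every $x$; $f\sim h$ means $\mathcal{S}(f)$ and $\mathcal{S}(h)$ are isomorphic. -}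

module Defs where

open import Data.Bool using (Bool; true; false; not)
open import Data.Nat using (ℕ; suc; _*_; _^_; _≤_)
open import Data.Fin using (Fin)
open import Data.Vec using (Vec; lookup; updateAt)
open import Data.List using (List; length)
open import Data.List.Membership.Propositional using (_∈_)
open import Data.List.Relation.Unary.All using (All)
open import Data.List.Relation.Unary.AllPairs using (AllPairs)
open import Data.Product using (Σ; ∃; _×_)
open import Relation.Binary.PropositionalEquality using (_≡_; _≢_)
open import Function.Bundles using (_↔_; _⇔_; Inverse)

Config : ℕ → Set
Config n = Vec Bool n

Fn : ℕ → Set
Fn n = Config n → Config n

flipAt : ∀ {n} → Config n → Fin n → Config n
flipAt x i = updateAt x i not

AArc : ∀ {n} → Fn n → Config n → Config n → Set
AArc {n} f x y = Σ (Fin n) λ i → (lookup (f x) i ≢ lookup x i) × (y ≡ flipAt x i)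

Subset : ℕ → Set
Subset n = Config n → Bool

_∈S_ : ∀ {n} → Config n → Subset n → Set
x ∈S X = X x ≡ true

_⊆S_ : ∀ {n} → Subset n → Subset n → Set
X ⊆S Y = ∀ x → x ∈S X → x ∈S Y

NonEmpty : ∀ {n} → Subset n → Set
NonEmpty X = ∃ λ x → x ∈S X

Trap : ∀ {n} → Fn n → Subset n → Set
Trap f X = ∀ x y → x ∈S X → AArc f x y → y ∈S X

IsAttractor : ∀ {n} → Fn n → Subset n → Set
IsAttractor f X =
  NonEmpty X × Trap f X ×
  (∀ Y → Y ⊆S X → NonEmpty Y → Trap f Y → X ⊆S Y)

SizeAtMost : ∀ {n} → ℕ → Subset n → Set
SizeAtMost {n} k X = Σ (List (Config n)) λ L → (length L ≤ k) × (∀ x → x ∈S X → x ∈ L)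

DistinctSubsets : ∀ {n} → Subset n → Subset n → Set
DistinctSubsets X Y = ∃ λ x → X x ≢ Y x

DistinctFns : ∀ {n} → Fn n → Fn n → Set
DistinctFns f g = ∃ λ x → f x ≢ g x

-- f ~ h : the digraphs S(f) (arcs x → f x) and S(h) are isomorphic
_∼_ : ∀ {n} → Fn n → Fn n → Set
_∼_ {n} f h = Σ (Config n ↔ Config n) λ φ →
  ∀ x y → (f x ≡ y) ⇔ (h (Inverse.to φ x) ≡ Inverse.to φ y)

ManySmallAttractors : ∀ {n} → Fn n → Set
ManySmallAttractors {n} h = Σ (List (Subset n)) λ As →
  AllPairs DistinctSubsets As ×
  All (λ X → IsAttractor h X × SizeAtMost 4 X) As ×
  (46 * 2 ^ n ≤ 1000 * length As)

Good : ∀ {n} → Fn n → Set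
Good {n} f = Σ (Fn n) λ h → (h ∼ f) × ManySmallAttractors h

cardF : ℕ → ℕ
cardF n = (2 ^ n) ^ (2 ^ n)

{-# OPTIONS --safe #-}

-- Two vertex-disjoint chains a → x → c and b → y → d of f can be placed in a 3-dimensional subcube as
-- a = 100, x = 000, c = 110, b = 011, y = 010, d = 001; then {a, x, y, b} is an attractor of size 4
-- whatever the values at c and d are. Hence it suffices to find 0.092 · 2^n disjoint chains.
-- Let N = 2^n. Expose f first on the configurations with first bit 1: about (1/2)(1 - e^{-1/2}) N > 3N/16
-- of the other configurations are hit. Take 3N/16 of these as middles x, choose a preimage a of each, and
-- expose f on the middles: among the 5N/8 configurations that are neither a chosen x nor a chosen a,
-- about (5/8)(1 - e^{-3/16}) N > 0.1 N are hit, and each is the end c of a chain, all disjoint.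
-- Both numbers of missed configurations are concentrated by Chebyshev's inequality, because the events
-- "y is missed" are negatively correlated.
module Submission where

open import Defs
open import Data.Bool using (Bool; true; false; if_then_else_)
import Data.Bool.Properties as Bool
open import Data.Fin using (zero; suc)
open import Data.List using (List; []; _∷_; _++_; length; map; take; zip; concatMap; filter; cartesianProductWith)
open import Data.List.Properties using (length-map; length-take; length-++)
import Data.List.Membership.DecPropositional as DecMembership
open import Data.List.Membership.Propositional using (_∈_; _∉_)
open import Data.List.Membership.Propositional.Properties using (∈-map⁺; ∈-++⁺ˡ; ∈-++⁺ʳ)
open import Data.List.Relation.Unary.All as All using (All; []; _∷_)
import Data.List.Relation.Unary.All.Properties as All
open import Data.List.Relation.Unary.AllPairs as AllPairs using (AllPairs; []; _∷_)
import Data.List.Relation.Unary.AllPairs.Properties as AllPairs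
open import Data.List.Relation.Unary.Any using (here; there)
open import Data.List.Relation.Unary.Unique.Propositional using (Unique)
open import Data.Nat hiding (_≟_)
import Data.Nat as ℕ
open import Data.Nat.Properties hiding (_≟_)
open import Data.Nat.Tactic.RingSolver using (solve-∀)
open import Data.Product using (Σ; ∃; _×_; _,_; proj₁; proj₂)
open import Data.Sum using (inj₁; inj₂)
open import Data.Unit using (tt)
open import Data.Vec using ([]; _∷_; lookup; drop; replicate)
import Data.Vec.Properties as Vec
open import Function using (_∘_; id)
open import Function.Bundles using (_↔_; Inverse; mk↔ₛ′; mk⇔)
open import Function.Properties.Inverse using (↔-refl; ↔-trans)
open import Relation.Binary.PropositionalEquality hiding (J)
open import Relation.Nullary using (¬_; Dec; yes; no; does; contradiction; ¬?; _×-dec_)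
open import Relation.Nullary.Decidable using (dec-true; dec-false)

infix 4 _≟_
_≟_ : ∀ {n} (x y : Config n) → Dec (x ≡ y)
_≟_ = Vec.≡-dec Bool._≟_

-- Extending partial injections to permutations

swap : ∀ {n} → Config n → Config n → Config n → Config n
swap p q x with x ≟ p
... | yes _ = q
... | no  _ with x ≟ q
...   | yes _ = p
...   | no  _ = x

swap-left : ∀ {n} (p q : Config n) → swap p q p ≡ q
swap-left p q with p ≟ p
... | yes _ = refl
... | no p≢p = contradiction refl p≢p

swap-right : ∀ {n} (p q : Config n) → swap p q q ≡ p
swap-right p q with q ≟ p
... | yes q≡p = q≡p
... | no _ with q ≟ q
...   | yes _ = refl
...   | no q≢q = contradiction refl q≢q

swap-other : ∀ {n} (p q : Config n) {x} → x ≢ p → x ≢ q → swap p q x ≡ x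
swap-other p q {x} x≢p x≢q with x ≟ p
... | yes x≡p = contradiction x≡p x≢p
... | no _ with x ≟ q
...   | yes x≡q = contradiction x≡q x≢q
...   | no _ = refl

swap-involutive : ∀ {n} (p q x : Config n) → swap p q (swap p q x) ≡ x
swap-involutive p q x with x ≟ p
... | yes refl = swap-right x q
... | no x≢p with x ≟ q
...   | yes refl = swap-left p x
...   | no x≢q = swap-other p q x≢p x≢q

swap↔ : ∀ {n} → Config n → Config n → Config n ↔ Config n
swap↔ p q = mk↔ₛ′ (swap p q) (swap p q) (swap-involutive p q) (swap-involutive p q)

to-injective : ∀ {n} (φ : Config n ↔ Config n) {x y} →
  Inverse.to φ x ≡ Inverse.to φ y → x ≡ y
to-injective φ {x} {y} e =
  trans (sym (Inverse.strictlyInverseʳ φ x))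
    (trans (cong (Inverse.from φ) e) (Inverse.strictlyInverseʳ φ y))

Sends : ∀ {n} → Config n ↔ Config n → Config n × Config n → Set
Sends φ (l , v) = Inverse.to φ l ≡ v

-- The bijection found for the tails is followed by the transposition of the current image of `l`
-- with `v`. Earlier pairs survive, because injectivity and uniqueness keep their images away from
-- both swapped points. Since `zip` truncates, the two lists may have different lengths.
extend : ∀ {n} (ls vs : List (Config n)) → Unique ls → Unique vs →
  Σ (Config n ↔ Config n) λ φ → All (Sends φ) (zip ls vs)
extend []       vs       _ _ = ↔-refl , []
extend (l ∷ ls) []       _ _ = ↔-refl , []
extend (l ∷ ls) (v ∷ vs) (l∉ ∷ uls) (v∉ ∷ uvs) =
  let (φ , sends) = extend ls vs uls uvs in
  ↔-trans φ (swap↔ (Inverse.to φ l) v) ,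
  swap-left (Inverse.to φ l) v ∷ keep φ ls vs l∉ v∉ sends
  where
  keep : ∀ φ ls vs → All (l ≢_) ls → All (v ≢_) vs → All (Sends φ) (zip ls vs) →
    All (Sends (↔-trans φ (swap↔ (Inverse.to φ l) v))) (zip ls vs)
  keep φ [] vs _ _ _ = []
  keep φ (_ ∷ _) [] _ _ _ = []
  keep φ (l′ ∷ ls) (v′ ∷ vs) (l≢l′ ∷ l∉) (v≢v′ ∷ v∉) (refl ∷ s) =
    swap-other _ v (λ e → l≢l′ (sym (to-injective φ e))) (≢-sym v≢v′) ∷ keep φ ls vs l∉ v∉ s

conjugate : ∀ {n} → Config n ↔ Config n → Fn n → Fn n
conjugate φ f = Inverse.from φ ∘ f ∘ Inverse.to φ

-- A place `l` of the new cube carries the vertex `Inverse.to φ l` of `f`, so `φ` itself is the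
-- isomorphism. Choosing `h` amounts to choosing where the vertices are placed.
conjugate-∼ : ∀ {n} (φ : Config n ↔ Config n) (f : Fn n) → conjugate φ f ∼ f
conjugate-∼ φ f = φ , λ x y → mk⇔
  (λ e → trans (sym (Inverse.strictlyInverseˡ φ _)) (cong (Inverse.to φ) e))
  (λ e → trans (cong (Inverse.from φ) e) (Inverse.strictlyInverseʳ φ y))

conjugate-step : ∀ {n} (φ : Config n ↔ Config n) (f : Fn n) {l l′ u v} →
  Sends φ (l , u) → f u ≡ v → Sends φ (l′ , v) → conjugate φ f l ≡ l′
conjugate-step φ f refl refl e =
  trans (cong (Inverse.from φ) (sym e)) (Inverse.strictlyInverseʳ φ _)

-- Attractors of size four

pattern #0 = false
pattern #1 = true

cell : ∀ {m} → Config m → Subset (3 + m)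
cell z (#1 ∷ #0 ∷ #0 ∷ w) = does (w ≟ z)
cell z (#0 ∷ #0 ∷ #0 ∷ w) = does (w ≟ z)
cell z (#0 ∷ #1 ∷ #0 ∷ w) = does (w ≟ z)
cell z (#0 ∷ #1 ∷ #1 ∷ w) = does (w ≟ z)
cell z _                  = false

data InCell {m} (z : Config m) : Config (3 + m) → Set where
  p₁ : InCell z (#1 ∷ #0 ∷ #0 ∷ z)
  p₂ : InCell z (#0 ∷ #0 ∷ #0 ∷ z)
  p₃ : InCell z (#0 ∷ #1 ∷ #0 ∷ z)
  p₄ : InCell z (#0 ∷ #1 ∷ #1 ∷ z)

does-≟ : ∀ {n} {w z : Config n} → does (w ≟ z) ≡ true → w ≡ z
does-≟ {w = w} {z} e with w ≟ z
... | yes w≡z = w≡z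

cell⇒InCell : ∀ {m} (z : Config m) x → x ∈S cell z → InCell z x
cell⇒InCell z (#1 ∷ #0 ∷ #0 ∷ w) e with refl ← does-≟ {w = w} e = p₁
cell⇒InCell z (#0 ∷ #0 ∷ #0 ∷ w) e with refl ← does-≟ {w = w} e = p₂
cell⇒InCell z (#0 ∷ #1 ∷ #0 ∷ w) e with refl ← does-≟ {w = w} e = p₃
cell⇒InCell z (#0 ∷ #1 ∷ #1 ∷ w) e with refl ← does-≟ {w = w} e = p₄

InCell⇒cell : ∀ {m} {z : Config m} {x} → InCell z x → x ∈S cell z
InCell⇒cell {z = z} p₁ = dec-true (z ≟ z) refl
InCell⇒cell {z = z} p₂ = dec-true (z ≟ z) refl
InCell⇒cell {z = z} p₃ = dec-true (z ≟ z) refl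
InCell⇒cell {z = z} p₄ = dec-true (z ≟ z) refl

cell-size : ∀ {m} (z : Config m) → SizeAtMost 4 (cell z)
cell-size z =
  (#1 ∷ #0 ∷ #0 ∷ z) ∷ (#0 ∷ #0 ∷ #0 ∷ z) ∷ (#0 ∷ #1 ∷ #0 ∷ z) ∷ (#0 ∷ #1 ∷ #1 ∷ z) ∷ [] ,
  ≤-refl , λ x x∈ → listed (cell⇒InCell z x x∈)
  where
  listed : ∀ {x} → InCell z x → x ∈ _
  listed p₁ = here refl
  listed p₂ = there (here refl)
  listed p₃ = there (there (here refl))
  listed p₄ = there (there (there (here refl)))

cell-distinct : ∀ {m} {z z′ : Config m} → z ≢ z′ → DistinctSubsets (cell z) (cell z′)
cell-distinct {z = z} {z′} z≢z′ = (#0 ∷ #0 ∷ #0 ∷ z) , λ e →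
  z≢z′ (does-≟ {w = z} (trans (sym e) (dec-true (z ≟ z) refl)))

-- The middle configurations 000z and 010z of the path 100z – 000z – 010z – 011z leave the cell
-- under h, yet every single coordinate of the move stays inside it.
record Cycling {m} (h : Fn (3 + m)) (z : Config m) : Set where
  field
    step₁ : h (#1 ∷ #0 ∷ #0 ∷ z) ≡ #0 ∷ #0 ∷ #0 ∷ z
    step₂ : h (#0 ∷ #0 ∷ #0 ∷ z) ≡ #1 ∷ #1 ∷ #0 ∷ z
    step₃ : h (#0 ∷ #1 ∷ #0 ∷ z) ≡ #0 ∷ #0 ∷ #1 ∷ z
    step₄ : h (#0 ∷ #1 ∷ #1 ∷ z) ≡ #0 ∷ #1 ∷ #0 ∷ z

module _ {m : ℕ} {h : Fn (3 + m)} {z : Config m} (cyc : Cycling h z) where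
  open Cycling cyc

  -- The asynchronous arcs out of the four configurations are exactly the edges of the path, each in
  -- both directions.
  cell-trap : Trap h (cell z)
  cell-trap x y x∈ (i , d , refl) = InCell⇒cell (go (cell⇒InCell z x x∈) i d)
    where
    go : ∀ {x} → InCell z x → ∀ i → lookup (h x) i ≢ lookup x i → InCell z (flipAt x i)
    go p₁ i d rewrite step₁ with i
    ... | zero              = p₂
    ... | suc zero          = contradiction refl d
    ... | suc (suc zero)    = contradiction refl d
    ... | suc (suc (suc _)) = contradiction refl d
    go p₂ i d rewrite step₂ with i
    ... | zero              = p₁
    ... | suc zero          = p₃
    ... | suc (suc zero)    = contradiction refl d
    ... | suc (suc (suc _)) = contradiction refl d
    go p₃ i d rewrite step₃ with i
    ... | zero              = contradiction refl d
    ... | suc zero          = p₂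
    ... | suc (suc zero)    = p₄
    ... | suc (suc (suc _)) = contradiction refl d
    go p₄ i d rewrite step₄ with i
    ... | zero              = contradiction refl d
    ... | suc zero          = contradiction refl d
    ... | suc (suc zero)    = p₃
    ... | suc (suc (suc _)) = contradiction refl d

  -- The path with both directions of its edges is strongly connected: a trap meeting it is led to
  -- 000z, and from there to the other three configurations.
  cell-minimal : ∀ Y → Y ⊆S cell z → NonEmpty Y → Trap h Y → cell z ⊆S Y
  cell-minimal Y Y⊆ (y , y∈) trap x x∈ = fromCentre (toCentre (cell⇒InCell z y (Y⊆ y y∈)) y∈) (cell⇒InCell z x x∈)
    where
    arc : ∀ {x y} i → h x ≡ y → lookup y i ≢ lookup x i → x ∈S Y → flipAt x i ∈S Y
    arc {x} i e d x∈ = trap x _ x∈ (i , subst (λ y → lookup y i ≢ lookup x i) (sym e) d , refl)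

    toCentre : ∀ {y} → InCell z y → y ∈S Y → (#0 ∷ #0 ∷ #0 ∷ z) ∈S Y
    toCentre p₁ = arc zero step₁ λ()
    toCentre p₂ = id
    toCentre p₃ = arc (suc zero) step₃ λ()
    toCentre p₄ = arc (suc zero) step₃ (λ()) ∘ arc (suc (suc zero)) step₄ λ()

    fromCentre : (#0 ∷ #0 ∷ #0 ∷ z) ∈S Y → ∀ {x} → InCell z x → x ∈S Y
    fromCentre o p₁ = arc zero step₂ (λ()) o
    fromCentre o p₂ = o
    fromCentre o p₃ = arc (suc zero) step₂ (λ()) o
    fromCentre o p₄ = arc (suc (suc zero)) step₃ (λ()) (fromCentre o p₃)

  cell-attractor : IsAttractor h (cell z)
  cell-attractor = ((#0 ∷ #0 ∷ #0 ∷ z) , InCell⇒cell {z = z} p₂) , cell-trap , cell-minimal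

-- Packing disjoint chains a → x → c

-- The order matches two consecutive lists `trio`: places for a, x, c, then for b, y, d. The third
-- place of each triple lies outside the cell.
slots : ∀ {m} → Config m → List (Config (3 + m))
slots z =
  (#1 ∷ #0 ∷ #0 ∷ z) ∷ (#0 ∷ #0 ∷ #0 ∷ z) ∷ (#1 ∷ #1 ∷ #0 ∷ z) ∷
  (#0 ∷ #1 ∷ #1 ∷ z) ∷ (#0 ∷ #1 ∷ #0 ∷ z) ∷ (#0 ∷ #0 ∷ #1 ∷ z) ∷ []

slots-unique : ∀ {m} {zs : List (Config m)} → Unique zs → Unique (concatMap slots zs)
slots-unique uzs = AllPairs.concat⁺
  (All.map⁺ (All.universal (λ z →
    ((λ()) ∷ (λ()) ∷ (λ()) ∷ (λ()) ∷ (λ()) ∷ []) ∷ ((λ()) ∷ (λ()) ∷ (λ()) ∷ (λ()) ∷ []) ∷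
    ((λ()) ∷ (λ()) ∷ (λ()) ∷ []) ∷ ((λ()) ∷ (λ()) ∷ []) ∷ ((λ()) ∷ []) ∷ [] ∷ []) _))
  (AllPairs.map⁺ (AllPairs.map apart uzs))
  where
  over : ∀ {m} (z : Config m) → All (λ l → drop 3 l ≡ z) (slots z)
  over z = refl ∷ refl ∷ refl ∷ refl ∷ refl ∷ refl ∷ []
  apart : ∀ {m} {z z′ : Config m} → z ≢ z′ →
    All (λ l → All (λ l′ → l ≢ l′) (slots z′)) (slots z)
  apart {z = z} {z′} z≢z′ =
    All.map (λ { refl → All.map (λ { refl refl → z≢z′ refl }) (over z′) }) (over z)

AllPairs-refine : ∀ {A : Set} {P : A → Set} {R S : A → A → Set} →
  (∀ {x y} → P x → P y → R x y → S x y) →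
  ∀ {xs} → All P xs → AllPairs R xs → AllPairs S xs
AllPairs-refine f [] [] = []
AllPairs-refine f (p ∷ ps) (r ∷ rs) =
  All.zipWith (λ { (q , r) → f p q r }) (ps , r) ∷ AllPairs-refine f ps rs

-- A chain is indexed by its end: as `f` is a function, distinct ends force distinct middles, and
-- these force distinct starts. `S` separates starts and middles from ends; the parameter `a≢x` of
-- `Packing` separates starts from middles.
record Chain {n} (f : Fn n) (S : Config n → Set) (a x : Config n → Config n)
             (c : Config n) : Set where
  field
    fa≡x : f (a c) ≡ x c
    fx≡c : f (x c) ≡ c
    a∈S  : S (a c)
    x∈S  : S (x c)
    c∉S  : ¬ S c

module Packing {m : ℕ} (f : Fn (3 + m)) (S : Config (3 + m) → Set)
  (a x : Config (3 + m) → Config (3 + m)) (a≢x : ∀ c c′ → a c ≢ x c′) where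

  trio : Config (3 + m) → List (Config (3 + m))
  trio c = a c ∷ x c ∷ c ∷ []

  trios-unique : ∀ {cs} → All (Chain f S a x) cs → Unique cs → Unique (concatMap trio cs)
  trios-unique chains ucs = AllPairs.concat⁺
    (All.map⁺ (All.map inner chains)) (AllPairs.map⁺ (AllPairs-refine outer chains ucs))
    where
    open Chain
    inner : ∀ {c} → Chain f S a x c → Unique (trio c)
    inner {c} h = (a≢x c c ∷ a≢c ∷ []) ∷ (x≢c ∷ []) ∷ [] ∷ []
      where
      a≢c : a c ≢ c
      a≢c e = c∉S h (subst S e (a∈S h))
      x≢c : x c ≢ c
      x≢c e = c∉S h (subst S e (x∈S h))
    outer : ∀ {c c′} → Chain f S a x c → Chain f S a x c′ → c ≢ c′ →
      All (λ u → All (λ v → u ≢ v) (trio c′)) (trio c)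
    outer {c} {c′} h h′ c≢c′ =
      (a≢a′ ∷ a≢x c c′ ∷ (λ e → c∉S h′ (subst S e (a∈S h))) ∷ []) ∷
      ((λ e → a≢x c′ c (sym e)) ∷ x≢x′ ∷ (λ e → c∉S h′ (subst S e (x∈S h))) ∷ []) ∷
      ((λ e → c∉S h (subst S (sym e) (a∈S h′))) ∷ (λ e → c∉S h (subst S (sym e) (x∈S h′))) ∷ c≢c′ ∷ []) ∷ []
      where
      x≢x′ : x c ≢ x c′
      x≢x′ e = c≢c′ (trans (sym (fx≡c h)) (trans (cong f e) (fx≡c h′)))
      a≢a′ : a c ≢ a c′
      a≢a′ e = x≢x′ (trans (sym (fa≡x h)) (trans (cong f e) (fa≡x h′)))

  cycling : ∀ (φ : Config (3 + m) ↔ Config (3 + m)) M {zs cs} → All (Chain f S a x) cs →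
    All (Sends φ) (zip (concatMap slots zs) (concatMap trio cs)) →
    M * 2 ≤ length cs → All (Cycling (conjugate φ f)) (take M zs)
  cycling φ zero _ _ _ = []
  cycling φ (suc M) {[]} _ _ _ = []
  cycling φ (suc M) {z ∷ zs} (h ∷ h′ ∷ chains) (s₁ ∷ s₂ ∷ s₃ ∷ s₄ ∷ s₅ ∷ s₆ ∷ ss) (s≤s (s≤s le)) =
    record
      { step₁ = conjugate-step φ f s₁ (fa≡x h) s₂
      ; step₂ = conjugate-step φ f s₂ (fx≡c h) s₃
      -- The second triple puts b, y, d at 011z, 010z, 001z, so the middle comes from `s₅` and its
      -- end from `s₆`.
      ; step₃ = conjugate-step φ f s₅ (fx≡c h′) s₆
      ; step₄ = conjugate-step φ f s₄ (fa≡x h′) s₅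
      } ∷ cycling φ M chains ss le
    where open Chain

  chains⇒Good : ∀ M {zs cs} → Unique zs → Unique cs → All (Chain f S a x) cs →
    M ≤ length zs → M * 2 ≤ length cs → 46 * 2 ^ (3 + m) ≤ 1000 * M → Good f
  chains⇒Good M {zs} uzs ucs chains M≤ 2M≤ bound =
    let (φ , sends) = extend _ _ (slots-unique uzs) (trios-unique chains ucs) in
    conjugate φ f , conjugate-∼ φ f ,
    map cell (take M zs) ,
    AllPairs.map⁺ (AllPairs.map cell-distinct (AllPairs.take⁺ M uzs)) ,
    All.map⁺ (All.map (λ {z} cyc → cell-attractor cyc , cell-size z) (cycling φ M chains sends 2M≤)) ,
    ≤-trans bound (≤-reflexive (cong (1000 *_) (sym (trans (length-map cell (take M zs))
      (trans (length-take M zs) (m≤n⇒m⊓n≡m M≤))))))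

-- Sums, products and indicators

∑ : ∀ {A : Set} → List A → (A → ℕ) → ℕ
∑ []       F = 0
∑ (x ∷ xs) F = F x + ∑ xs F

private variable
  A B C : Set

∑-cong : ∀ (xs : List A) {F G : A → ℕ} → (∀ x → F x ≡ G x) → ∑ xs F ≡ ∑ xs G
∑-cong []       eq = refl
∑-cong (x ∷ xs) eq = cong₂ _+_ (eq x) (∑-cong xs eq)

∑-mono : ∀ (xs : List A) {F G : A → ℕ} → (∀ x → F x ≤ G x) → ∑ xs F ≤ ∑ xs G
∑-mono []       le = z≤n
∑-mono (x ∷ xs) le = +-mono-≤ (le x) (∑-mono xs le)

∑-+ : ∀ (xs : List A) (F G : A → ℕ) → ∑ xs (λ x → F x + G x) ≡ ∑ xs F + ∑ xs G
∑-+ []       F G = refl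
∑-+ (x ∷ xs) F G rewrite ∑-+ xs F G = +-interchange (F x) (G x) (∑ xs F) (∑ xs G)
  where
  +-interchange : ∀ a b c d → a + b + (c + d) ≡ a + c + (b + d)
  +-interchange = solve-∀

∑-*ˡ : ∀ (xs : List A) k (F : A → ℕ) → ∑ xs (λ x → k * F x) ≡ k * ∑ xs F
∑-*ˡ []       k F = sym (*-zeroʳ k)
∑-*ˡ (x ∷ xs) k F rewrite ∑-*ˡ xs k F = sym (*-distribˡ-+ k (F x) (∑ xs F))

∑-*ʳ : ∀ (xs : List A) k (F : A → ℕ) → ∑ xs (λ x → F x * k) ≡ ∑ xs F * k
∑-*ʳ xs k F = trans (∑-cong xs (λ x → *-comm (F x) k)) (trans (∑-*ˡ xs k F) (*-comm k _))

∑-const : ∀ (xs : List A) k → ∑ xs (λ _ → k) ≡ length xs * k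
∑-const []       k = refl
∑-const (x ∷ xs) k = cong (k +_) (∑-const xs k)

∑-1 : ∀ (xs : List A) → ∑ xs (λ _ → 1) ≡ length xs
∑-1 xs = trans (∑-const xs 1) (*-identityʳ _)

∑-++ : ∀ (xs ys : List A) F → ∑ (xs ++ ys) F ≡ ∑ xs F + ∑ ys F
∑-++ []       ys F = refl
∑-++ (x ∷ xs) ys F rewrite ∑-++ xs ys F = sym (+-assoc (F x) _ _)

∑-map : ∀ (g : A → B) xs F → ∑ (map g xs) F ≡ ∑ xs (F ∘ g)
∑-map g []       F = refl
∑-map g (x ∷ xs) F = cong (F (g x) +_) (∑-map g xs F)

∑-cartesian : ∀ (g : A → B → C) xs ys F →
  ∑ (cartesianProductWith g xs ys) F ≡ ∑ xs λ x → ∑ ys λ y → F (g x y)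
∑-cartesian g []       ys F = refl
∑-cartesian g (x ∷ xs) ys F
  rewrite ∑-++ (map (g x) ys) (cartesianProductWith g xs ys) F
        | ∑-map (g x) ys F | ∑-cartesian g xs ys F = refl

∑-swap : ∀ (xs : List A) (ys : List B) (F : A → B → ℕ) →
  (∑ xs λ x → ∑ ys λ y → F x y) ≡ (∑ ys λ y → ∑ xs λ x → F x y)
∑-swap []       ys F = sym (trans (∑-const ys 0) (*-zeroʳ (length ys)))
∑-swap (x ∷ xs) ys F rewrite ∑-swap xs ys F = sym (∑-+ ys (F x) (λ y → ∑ xs λ x → F x y))

∑-product : ∀ (xs : List A) (ys : List B) (F : A → ℕ) (G : B → ℕ) →
  (∑ xs λ x → ∑ ys λ y → F x * G y) ≡ ∑ xs F * ∑ ys G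
∑-product xs ys F G = trans (∑-cong xs (λ x → ∑-*ˡ ys (F x) G)) (∑-*ʳ xs (∑ ys G) F)

𝟙 : ∀ {P : Set} → Dec P → ℕ
𝟙 d = if does d then 1 else 0

𝟙-yes : ∀ {P : Set} (d : Dec P) → P → 𝟙 d ≡ 1
𝟙-yes d p rewrite dec-true d p = refl

𝟙-no : ∀ {P : Set} (d : Dec P) → ¬ P → 𝟙 d ≡ 0
𝟙-no d ¬p rewrite dec-false d ¬p = refl

𝟙≤1 : ∀ {P : Set} (d : Dec P) → 𝟙 d ≤ 1
𝟙≤1 (yes _) = ≤-refl
𝟙≤1 (no _)  = z≤n

𝟙-¬? : ∀ {P : Set} (d : Dec P) → 𝟙 d + 𝟙 (¬? d) ≡ 1
𝟙-¬? (yes _) = refl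
𝟙-¬? (no _)  = refl

length-filter-∑ : ∀ {P : A → Set} (P? : ∀ x → Dec (P x)) xs →
  length (filter P? xs) ≡ ∑ xs (λ x → 𝟙 (P? x))
length-filter-∑ P? []       = refl
length-filter-∑ P? (x ∷ xs) with P? x
... | yes _ = cong suc (length-filter-∑ P? xs)
... | no _  = length-filter-∑ P? xs

∑-𝟙-¬? : ∀ {P : A → Set} (P? : ∀ x → Dec (P x)) xs →
  ∑ xs (λ x → 𝟙 (P? x)) + ∑ xs (λ x → 𝟙 (¬? (P? x))) ≡ length xs
∑-𝟙-¬? P? xs = trans (sym (∑-+ xs _ _))
  (trans (∑-cong xs (λ x → 𝟙-¬? (P? x))) (∑-1 xs))

-- The recursion on the first bit is the one used by `functions`, so that sums over functions factor
-- along it.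
∏ : ∀ d → (Config d → ℕ) → ℕ
∏ zero    u = u []
∏ (suc d) u = ∏ d (u ∘ (true ∷_)) * ∏ d (u ∘ (false ∷_))

∏-cong : ∀ d {u w : Config d → ℕ} → (∀ x → u x ≡ w x) → ∏ d u ≡ ∏ d w
∏-cong zero    eq = eq []
∏-cong (suc d) eq = cong₂ _*_ (∏-cong d (eq ∘ (true ∷_))) (∏-cong d (eq ∘ (false ∷_)))

∏-mono : ∀ d {u w : Config d → ℕ} → (∀ x → u x ≤ w x) → ∏ d u ≤ ∏ d w
∏-mono zero    le = le []
∏-mono (suc d) le = *-mono-≤ (∏-mono d (le ∘ (true ∷_))) (∏-mono d (le ∘ (false ∷_)))

∏-* : ∀ d (u w : Config d → ℕ) → ∏ d (λ x → u x * w x) ≡ ∏ d u * ∏ d w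
∏-* zero    u w = refl
∏-* (suc d) u w rewrite ∏-* d (u ∘ (true ∷_)) (w ∘ (true ∷_)) | ∏-* d (u ∘ (false ∷_)) (w ∘ (false ∷_)) =
  [m*n]*[o*p]≡[m*o]*[n*p] (∏ d (u ∘ (true ∷_))) _ _ _

∏≡0 : ∀ d (u : Config d → ℕ) → ∏ d u ≡ 0 → ∃ λ x → u x ≡ 0
∏≡0 zero    u e = [] , e
∏≡0 (suc d) u e with m*n≡0⇒m≡0∨n≡0 (∏ d (u ∘ (true ∷_))) e
... | inj₁ e₁ = let (x , p) = ∏≡0 d _ e₁ in true ∷ x , p
... | inj₂ e₂ = let (x , p) = ∏≡0 d _ e₂ in false ∷ x , p

∏-const : ∀ d k → ∏ d (λ _ → k) ≡ k ^ (2 ^ d)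
∏-const zero    k = sym (*-identityʳ k)
∏-const (suc d) k rewrite ∏-const d k | +-identityʳ (2 ^ d) = sym (^-distribˡ-+-* k (2 ^ d) (2 ^ d))

-- Enumerating configurations and functions

configs : ∀ d → List (Config d)
configs zero    = [] ∷ []
configs (suc d) = map (true ∷_) (configs d) ++ map (false ∷_) (configs d)

configs-unique : ∀ d → Unique (configs d)
configs-unique zero    = [] ∷ []
configs-unique (suc d) = AllPairs.++⁺ (half true) (half false)
  (All.map⁺ (All.universal (λ _ → All.map⁺ (All.universal (λ _ ()) _)) _))
  where
  half : ∀ b → Unique (map (b ∷_) (configs d))
  half b = AllPairs.map⁺ (AllPairs.map (λ x≢y e → x≢y (Vec.∷-injectiveʳ e)) (configs-unique d))

∑-configs : ∀ d (F : Config (suc d) → ℕ) →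
  ∑ (configs (suc d)) F ≡ ∑ (configs d) (F ∘ (true ∷_)) + ∑ (configs d) (F ∘ (false ∷_))
∑-configs d F rewrite ∑-++ (map (true ∷_) (configs d)) (map (false ∷_) (configs d)) F
  | ∑-map (true ∷_) (configs d) F | ∑-map (false ∷_) (configs d) F = refl

length-configs : ∀ d → length (configs d) ≡ 2 ^ d
length-configs zero    = refl
length-configs (suc d) = begin
  length (configs (suc d))                               ≡⟨ ∑-1 (configs (suc d)) ⟨
  ∑ (configs (suc d)) (λ _ → 1)                          ≡⟨ ∑-configs d (λ _ → 1) ⟩
  ∑ (configs d) (λ _ → 1) + ∑ (configs d) (λ _ → 1)      ≡⟨ cong (λ s → s + s) (trans (∑-1 (configs d)) (length-configs d)) ⟩
  2 ^ d + 2 ^ d                                          ≡⟨ cong (2 ^ d +_) (+-identityʳ (2 ^ d)) ⟨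
  2 ^ suc d                                              ∎
  where open ≡-Reasoning

∑-≟ : ∀ {d} (y : Config d) → ∑ (configs d) (λ v → 𝟙 (v ≟ y)) ≡ 1
∑-≟ [] = refl
∑-≟ {suc d} (true ∷ y) rewrite ∑-configs d (λ v → 𝟙 (v ≟ true ∷ y))
  | ∑-≟ y | ∑-const (configs d) 0 | *-zeroʳ (length (configs d)) = refl
∑-≟ {suc d} (false ∷ y) rewrite ∑-configs d (λ v → 𝟙 (v ≟ false ∷ y))
  | ∑-≟ y | ∑-const (configs d) 0 | *-zeroʳ (length (configs d)) = refl

∑-≢ : ∀ {d} (y : Config d) → ∑ (configs d) (λ v → 𝟙 (¬? (v ≟ y))) ≡ 2 ^ d ∸ 1
∑-≢ {d} y = cong (_∸ 1) (begin
  1 + ∑ (configs d) (λ v → 𝟙 (¬? (v ≟ y)))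
    ≡⟨ cong (_+ ∑ (configs d) (λ v → 𝟙 (¬? (v ≟ y)))) (∑-≟ y) ⟨
  ∑ (configs d) (λ v → 𝟙 (v ≟ y)) + ∑ (configs d) (λ v → 𝟙 (¬? (v ≟ y)))
    ≡⟨ ∑-𝟙-¬? (_≟ y) (configs d) ⟩
  length (configs d)
    ≡⟨ length-configs d ⟩
  2 ^ d ∎)
  where open ≡-Reasoning

∑-≢₂ : ∀ {d} {y y′ : Config d} → y ≢ y′ →
  ∑ (configs d) (λ v → 𝟙 (¬? (v ≟ y)) * 𝟙 (¬? (v ≟ y′))) ≡ 2 ^ d ∸ 2
∑-≢₂ {d} {y} {y′} y≢y′ = cong (_∸ 2) (sym total)
  where
  F = λ v → 𝟙 (¬? (v ≟ y)) * 𝟙 (¬? (v ≟ y′))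
  pointwise : ∀ v → 𝟙 (v ≟ y) + (𝟙 (v ≟ y′) + F v) ≡ 1
  pointwise v with v ≟ y | v ≟ y′
  ... | yes refl | yes refl = contradiction refl y≢y′
  ... | yes _    | no _     = refl
  ... | no _     | yes _    = refl
  ... | no _     | no _     = refl
  total : 2 ^ d ≡ 2 + ∑ (configs d) F
  total = begin
    2 ^ d                ≡⟨ length-configs d ⟨
    length (configs d)   ≡⟨ ∑-1 (configs d) ⟨
    ∑ (configs d) (λ _ → 1) ≡⟨ ∑-cong (configs d) pointwise ⟨
    ∑ (configs d) (λ v → 𝟙 (v ≟ y) + (𝟙 (v ≟ y′) + F v)) ≡⟨ ∑-+ (configs d) _ _ ⟩
    ∑ (configs d) (λ v → 𝟙 (v ≟ y)) + ∑ (configs d) (λ v → 𝟙 (v ≟ y′) + F v)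
      ≡⟨ cong₂ _+_ (∑-≟ y) (∑-+ (configs d) _ _) ⟩
    1 + (∑ (configs d) (λ v → 𝟙 (v ≟ y′)) + ∑ (configs d) F)
      ≡⟨ cong (λ t → 1 + (t + ∑ (configs d) F)) (∑-≟ y′) ⟩
    2 + ∑ (configs d) F ∎
    where open ≡-Reasoning

-- The first bit splits a function into two independently chosen halves. They later become the two
-- rounds of exposure.
join : ∀ {d} → (Config d → C) → (Config d → C) → Config (suc d) → C
join g h (true  ∷ x) = g x
join g h (false ∷ x) = h x

functions : ∀ d → List C → List (Config d → C)
functions zero    vs = map (λ v _ → v) vs
functions (suc d) vs = cartesianProductWith join (functions d vs) (functions d vs)

length-functions : ∀ d (vs : List C) → length (functions d vs) ≡ length vs ^ (2 ^ d)
length-functions zero    vs = trans (length-map _ vs) (sym (*-identityʳ _))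
length-functions (suc d) vs = begin
  length (functions (suc d) vs)                  ≡⟨ ∑-1 (functions (suc d) vs) ⟨
  ∑ (functions (suc d) vs) (λ _ → 1)             ≡⟨ ∑-cartesian join F F _ ⟩
  (∑ F λ _ → ∑ F λ _ → 1)                        ≡⟨ ∑-const F _ ⟩
  length F * ∑ F (λ _ → 1)                       ≡⟨ cong (length F *_) (∑-1 F) ⟩
  length F * length F                            ≡⟨ cong (λ l → l * l) (length-functions d vs) ⟩
  length vs ^ (2 ^ d) * length vs ^ (2 ^ d)      ≡⟨ ^-distribˡ-+-* (length vs) (2 ^ d) (2 ^ d) ⟨
  length vs ^ (2 ^ d + 2 ^ d)                    ≡⟨ cong (λ e → length vs ^ (2 ^ d + e)) (+-identityʳ (2 ^ d)) ⟨
  length vs ^ (2 ^ suc d)                        ∎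
  where
  open ≡-Reasoning
  F = functions d vs

Distinct : ∀ {d} → (Config d → C) → (Config d → C) → Set
Distinct f g = ∃ λ x → f x ≢ g x

AllPairs-cartesian : ∀ {R : A → A → Set} {S : B → B → Set} {T : C → C → Set} {g : A → B → C} →
  (∀ {x x′} y y′ → R x x′ → T (g x y) (g x′ y′)) → (∀ x {y y′} → S y y′ → T (g x y) (g x y′)) →
  ∀ {xs ys} → AllPairs R xs → AllPairs S ys → AllPairs T (cartesianProductWith g xs ys)
AllPairs-cartesian r s [] sy = []
AllPairs-cartesian {g = g} r s {x ∷ xs} {ys} (rx ∷ rxs) sy = AllPairs.++⁺
  (AllPairs.map⁺ (AllPairs.map (s x) sy))
  (AllPairs-cartesian r s rxs sy)
  (All.map⁺ (All.universal (λ y → All.cartesianProductWith⁺ (setoid _) (setoid _) g xs ys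
    λ {x′} {y′} x′∈ _ → r y y′ (All.lookup rx x′∈)) ys))

functions-distinct : ∀ d {vs : List C} → Unique vs → AllPairs Distinct (functions d vs)
functions-distinct zero    uvs = AllPairs.map⁺ (AllPairs.map (λ v≢w → [] , v≢w) uvs)
functions-distinct (suc d) uvs = AllPairs-cartesian
  (λ { h h′ (x , p) → true ∷ x , p }) (λ { g (x , p) → false ∷ x , p })
  (functions-distinct d uvs) (functions-distinct d uvs)

-- Independence of the values of a random function, unnormalised: expanding the product of sums
-- chooses one value at every argument.
∑-functions : ∀ d (vs : List C) (w : Config d → C → ℕ) →
  ∑ (functions d vs) (λ f → ∏ d (λ x → w x (f x))) ≡ ∏ d (λ x → ∑ vs (w x))
∑-functions zero    vs w = ∑-map _ vs _
∑-functions (suc d) vs w = trans (∑-cartesian join (functions d vs) (functions d vs) _)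
  (trans (∑-product (functions d vs) (functions d vs) _ _)
    (cong₂ _*_ (∑-functions d vs (w ∘ (true ∷_))) (∑-functions d vs (w ∘ (false ∷_)))))

-- Chebyshev's inequality

-- This is (a - b)² ≥ e² with the cross term moved to the left, because subtraction of naturals
-- truncates.
square-gap : ∀ a b e → b + e ≤ a → 2 * (a * b) + e * e ≤ a * a + b * b
square-gap a b e le with m≤n⇒∃[o]m+o≡n le
... | r , refl = ≤-trans (m≤m+n _ (2 * (e * r) + r * r)) (≤-reflexive (expand b e r))
  where
  expand : ∀ b e r → 2 * ((b + e + r) * b) + e * e + (2 * (e * r) + r * r)
    ≡ (b + e + r) * (b + e + r) + b * b
  expand = solve-∀

2ab≤a²+b² : ∀ a b → 2 * (a * b) ≤ a * a + b * b
2ab≤a²+b² a b with ≤-total b a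
... | inj₁ b≤a = ≤-trans (m≤m+n _ 0) (square-gap a b 0 (≤-trans (≤-reflexive (+-identityʳ b)) b≤a))
... | inj₂ a≤b = subst₂ _≤_ (cong (2 *_) (*-comm b a)) (+-comm (b * b) (a * a))
  (≤-trans (m≤m+n _ 0) (square-gap b a 0 (≤-trans (≤-reflexive (+-identityʳ a)) a≤b)))

-- For `Z` on a uniformly random element of `xs`, `moment` says that the variance is at most the
-- mean, and `gap` that the mean lies at least `s` below `t`. Everything is multiplied by powers of
-- the length to stay in the naturals.
chebyshev : ∀ (xs : List A) .{{_ : NonZero (length xs)}} (Z : A → ℕ) s t →
  length xs * ∑ xs (λ x → Z x * Z x) ≤ ∑ xs Z * ∑ xs Z + length xs * ∑ xs Z →
  ∑ xs Z + length xs * s ≤ length xs * t →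
  ∑ xs (λ x → 𝟙 (t ≤? Z x)) * (s * s) ≤ length xs * t
chebyshev xs Z s t moment gap =
  -- The bound is first obtained with the total `T`, which `gap` then weakens to `W * t`.
  ≤-trans (*-cancelʳ-≤ _ _ (W * W) {{m*n≢0 W W}} bound) (≤-trans (m≤m+n T (W * s)) gap)
  where
  W = length xs
  T = ∑ xs Z
  Q = ∑ xs (λ x → Z x * Z x)
  # = ∑ xs (λ x → 𝟙 (t ≤? Z x))

  -- The square of W Z - T is at least (W s)² where t ≤ Z, and at least 0 elsewhere.
  pointwise : ∀ x (t≤?Z : Dec (t ≤ Z x)) →
    2 * (W * T) * Z x + 𝟙 t≤?Z * (W * s * (W * s)) ≤ W * W * (Z x * Z x) + T * T
  pointwise x (yes t≤Z) = subst₂ _≤_ (lhs W T (Z x) _) (cong (_+ T * T) (rhs W (Z x)))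
    (square-gap (W * Z x) T (W * s) (≤-trans gap (*-monoʳ-≤ W t≤Z)))
    where
    lhs : ∀ w t z e → 2 * (w * z * t) + e ≡ 2 * (w * t) * z + 1 * e
    lhs = solve-∀
    rhs : ∀ w z → w * z * (w * z) ≡ w * w * (z * z)
    rhs = solve-∀
  pointwise x (no _) = subst₂ _≤_ (lhs W T (Z x)) (cong (_+ T * T) (rhs W (Z x))) (2ab≤a²+b² (W * Z x) T)
    where
    lhs : ∀ w t z → 2 * (w * z * t) ≡ 2 * (w * t) * z + 0
    lhs = solve-∀
    rhs : ∀ w z → w * z * (w * z) ≡ w * w * (z * z)
    rhs = solve-∀

  summed : 2 * (W * T) * T + # * (W * s * (W * s)) ≤ W * W * Q + W * (T * T)
  summed = subst₂ _≤_
    (trans (∑-+ xs _ _) (cong₂ _+_ (∑-*ˡ xs (2 * (W * T)) Z) (∑-*ʳ xs (W * s * (W * s)) (λ x → 𝟙 (t ≤? Z x)))))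
    (trans (∑-+ xs _ _) (cong₂ _+_ (∑-*ˡ xs (W * W) (λ x → Z x * Z x)) (∑-const xs (T * T))))
    (∑-mono xs (λ x → pointwise x (t ≤? Z x)))

  bound : # * (s * s) * (W * W) ≤ T * (W * W)
  bound = +-cancelˡ-≤ (2 * (W * T) * T) _ _ (begin
    2 * (W * T) * T + # * (s * s) * (W * W)     ≡⟨ e₁ W T # s ⟩
    2 * (W * T) * T + # * (W * s * (W * s))     ≤⟨ summed ⟩
    W * W * Q + W * (T * T)                     ≡⟨ cong (_+ W * (T * T)) (*-assoc W W Q) ⟩
    W * (W * Q) + W * (T * T)                   ≤⟨ +-monoˡ-≤ _ (*-monoʳ-≤ W moment) ⟩
    W * (T * T + W * T) + W * (T * T)           ≡⟨ e₂ W T ⟩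
    2 * (W * T) * T + T * (W * W)               ∎)
    where
    open ≤-Reasoning
    e₁ : ∀ w t b s → 2 * (w * t) * t + b * (s * s) * (w * w) ≡ 2 * (w * t) * t + b * (w * s * (w * s))
    e₁ = solve-∀
    e₂ : ∀ w t → w * (t * t + w * t) + w * (t * t) ≡ 2 * (w * t) * t + t * (w * w)
    e₂ = solve-∀

-- Points missed by a random function

∑-≟-unique : ∀ {n} {ys : List (Config n)} → Unique ys → ∀ y → ∑ ys (λ y′ → 𝟙 (y′ ≟ y)) ≤ 1
∑-≟-unique [] y = z≤n
∑-≟-unique {ys = y′ ∷ ys} (y′∉ ∷ uys) y with y′ ≟ y
... | no _     = ∑-≟-unique uys y
... | yes refl = s≤s (≤-reflexive (absent y′∉))
  where
  absent : ∀ {ys} → All (y′ ≢_) ys → ∑ ys (λ z → 𝟙 (z ≟ y′)) ≡ 0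
  absent [] = refl
  absent {z ∷ _} (y′≢z ∷ ps) rewrite 𝟙-no (z ≟ y′) (≢-sym y′≢z) = absent ps

-- The number of functions into N values that send all of X into a fixed set of k values.
confined : ∀ d → (Config d → Bool) → ℕ → ℕ → ℕ
confined d X N k = ∏ d (λ x → if X x then k else N)

card : ∀ {d} → (Config d → Bool) → ℕ
card {d} X = ∑ (configs d) (λ x → if X x then 1 else 0)

-- The closed form is k ^ c * N ^ (2 ^ d - c) with c = `card X`; the factor `N ^ card X` removes the
-- subtraction from the exponent.
confined-card : ∀ d (X : Config d → Bool) N k →
  confined d X N k * N ^ card X ≡ k ^ card X * N ^ (2 ^ d)
confined-card zero X N k with X []
... | true  = cong (_* (N * 1)) (sym (*-identityʳ k))
... | false = trans (*-identityʳ N) (trans (sym (*-identityʳ N)) (sym (*-identityˡ (N * 1))))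
confined-card (suc d) X N k = begin
  u₁ * u₂ * N ^ card X                        ≡⟨ cong (λ c → u₁ * u₂ * N ^ c) split ⟩
  u₁ * u₂ * N ^ (c₁ + c₂)                     ≡⟨ cong (u₁ * u₂ *_) (^-distribˡ-+-* N c₁ c₂) ⟩
  u₁ * u₂ * (N ^ c₁ * N ^ c₂)                 ≡⟨ [m*n]*[o*p]≡[m*o]*[n*p] u₁ u₂ _ _ ⟩
  u₁ * N ^ c₁ * (u₂ * N ^ c₂)                 ≡⟨ cong₂ _*_ (confined-card d _ N k) (confined-card d _ N k) ⟩
  k ^ c₁ * N ^ (2 ^ d) * (k ^ c₂ * N ^ (2 ^ d)) ≡⟨ [m*n]*[o*p]≡[m*o]*[n*p] (k ^ c₁) _ _ _ ⟩
  k ^ c₁ * k ^ c₂ * (N ^ (2 ^ d) * N ^ (2 ^ d)) ≡⟨ cong₂ _*_ (^-distribˡ-+-* k c₁ c₂) (^-distribˡ-+-* N (2 ^ d) (2 ^ d)) ⟨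
  k ^ (c₁ + c₂) * N ^ (2 ^ d + 2 ^ d)         ≡⟨ cong₂ (λ c e → k ^ c * N ^ (2 ^ d + e)) split (+-identityʳ (2 ^ d)) ⟨
  k ^ card X * N ^ (2 ^ suc d)                ∎
  where
  open ≡-Reasoning
  u₁ = confined d (X ∘ (true ∷_)) N k
  u₂ = confined d (X ∘ (false ∷_)) N k
  c₁ = card (X ∘ (true ∷_))
  c₂ = card (X ∘ (false ∷_))
  split : card X ≡ c₁ + c₂
  split = ∑-configs d _

-- In probabilities, 1 - 2/N ≤ (1 - 1/N)²: for one random value, the events of avoiding two given
-- points are negatively correlated.
N[N-2]≤[N-1]² : ∀ N → N * (N ∸ 2) ≤ (N ∸ 1) * (N ∸ 1)
N[N-2]≤[N-1]² zero = z≤n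
N[N-2]≤[N-1]² (suc zero) = z≤n
N[N-2]≤[N-1]² (suc (suc m)) = ≤-trans (n≤1+n _) (≤-reflexive (square m))
  where
  square : ∀ m → 1 + (2 + m) * m ≡ (1 + m) * (1 + m)
  square = solve-∀

-- The inequality 1 + k/a ≤ (1 + 1/a) ^ k, cleared of denominators by a ^ (k + 1).
bernoulli : ∀ a k → a ^ k * (a + k) ≤ a * (a + 1) ^ k
bernoulli a zero    = ≤-reflexive (simplify a)
  where
  simplify : ∀ a → 1 * (a + 0) ≡ a * 1
  simplify = solve-∀
bernoulli a (suc k) = begin
  a * a ^ k * (a + suc k)                          ≡⟨ e₁ a (a ^ k) k ⟩
  a * (a ^ k * (a + k)) + a ^ k * a                ≤⟨ +-monoʳ-≤ (a * (a ^ k * (a + k))) (*-monoʳ-≤ (a ^ k) (m≤m+n a k)) ⟩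
  a * (a ^ k * (a + k)) + a ^ k * (a + k)          ≡⟨ e₂ a (a ^ k * (a + k)) ⟩
  (a + 1) * (a ^ k * (a + k))                      ≤⟨ *-monoʳ-≤ (a + 1) (bernoulli a k) ⟩
  (a + 1) * (a * (a + 1) ^ k)                      ≡⟨ e₃ a ((a + 1) ^ k) ⟩
  a * ((a + 1) * (a + 1) ^ k)                      ∎
  where
  open ≤-Reasoning
  e₁ : ∀ a b k → a * b * (a + (1 + k)) ≡ a * (b * (a + k)) + b * a
  e₁ = solve-∀
  e₂ : ∀ a b → a * b + b ≡ (a + 1) * b
  e₂ = solve-∀
  e₃ : ∀ a b → (a + 1) * (a * b) ≡ a * ((a + 1) * b)
  e₃ = solve-∀

^-distribʳ-* : ∀ m n k → (m * n) ^ k ≡ m ^ k * n ^ k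
^-distribʳ-* m n zero    = refl
^-distribʳ-* m n (suc k) = trans (cong (m * n *_) (^-distribʳ-* m n k)) ([m*n]*[o*p]≡[m*o]*[n*p] m n _ _)

-- (1 - 1/N)^K ≤ (1 + 1/N)^-K ≤ 16/17 for N = 16 K.
decay : ∀ K .{{_ : NonZero K}} → 17 * (16 * K ∸ 1) ^ K ≤ 16 * (16 * K) ^ K
decay K = *-cancelʳ-≤ _ _ (N ^ K) {{m^n≢0 N K {{m*n≢0 16 K}}}} (begin
  17 * M ^ K * N ^ K            ≡⟨ e₁ (M ^ K) (N ^ K) ⟩
  M ^ K * (17 * N ^ K)          ≤⟨ *-monoʳ-≤ (M ^ K) growth ⟩
  M ^ K * (16 * (N + 1) ^ K)    ≡⟨ e₂ (M ^ K) ((N + 1) ^ K) ⟩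
  16 * (M ^ K * (N + 1) ^ K)    ≡⟨ cong (16 *_) (^-distribʳ-* M (N + 1) K) ⟨
  16 * (M * (N + 1)) ^ K        ≤⟨ *-monoʳ-≤ 16 (^-monoˡ-≤ K (below N)) ⟩
  16 * (N * N) ^ K              ≡⟨ cong (16 *_) (^-distribʳ-* N N K) ⟩
  16 * (N ^ K * N ^ K)          ≡⟨ *-assoc 16 (N ^ K) (N ^ K) ⟨
  16 * N ^ K * N ^ K            ∎)
  where
  open ≤-Reasoning
  N = 16 * K
  M = N ∸ 1
  e₁ : ∀ a b → 17 * a * b ≡ a * (17 * b)
  e₁ = solve-∀
  e₂ : ∀ a b → a * (16 * b) ≡ 16 * (a * b)
  e₂ = solve-∀
  below : ∀ N → (N ∸ 1) * (N + 1) ≤ N * N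
  below zero    = z≤n
  below (suc m) = ≤-trans (n≤1+n _) (≤-reflexive (square m))
    where
    square : ∀ m → 1 + m * (1 + m + 1) ≡ (1 + m) * (1 + m)
    square = solve-∀
  growth : 17 * N ^ K ≤ 16 * (N + 1) ^ K
  growth = *-cancelʳ-≤ _ _ K (subst₂ _≤_ (e₃ (N ^ K) K) (e₄ K ((N + 1) ^ K)) (bernoulli N K))
    where
    e₃ : ∀ b k → b * (16 * k + k) ≡ 17 * b * k
    e₃ = solve-∀
    e₄ : ∀ k b → 16 * k * b ≡ 16 * b * k
    e₄ = solve-∀

-- `decay` is raised to the power `r`, which is why the size of `X` has to be a multiple of `K`. The
-- rational (16/17) ^ r stands in for e ^ (-r/16).
confined-decay : ∀ d (X : Config d → Bool) K r .{{_ : NonZero K}} → card X ≡ K * r →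
  17 ^ r * confined d X (16 * K) (16 * K ∸ 1) ≤ 16 ^ r * (16 * K) ^ (2 ^ d)
confined-decay d X K r card≡ = *-cancelʳ-≤ _ _ (N ^ c) {{m^n≢0 N c {{m*n≢0 16 K}}}} (begin
  17 ^ r * confined d X N M * N ^ c         ≡⟨ *-assoc (17 ^ r) _ _ ⟩
  17 ^ r * (confined d X N M * N ^ c)       ≡⟨ cong (17 ^ r *_) (subst (λ c → confined d X N M * N ^ c ≡ M ^ c * N ^ (2 ^ d)) card≡ (confined-card d X N M)) ⟩
  17 ^ r * (M ^ c * N ^ (2 ^ d))            ≡⟨ *-assoc (17 ^ r) (M ^ c) (N ^ (2 ^ d)) ⟨
  17 ^ r * M ^ c * N ^ (2 ^ d)              ≤⟨ *-monoˡ-≤ (N ^ (2 ^ d)) powers ⟩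
  16 ^ r * N ^ c * N ^ (2 ^ d)              ≡⟨ rotate (16 ^ r) (N ^ c) (N ^ (2 ^ d)) ⟩
  16 ^ r * N ^ (2 ^ d) * N ^ c              ∎)
  where
  open ≤-Reasoning
  N = 16 * K
  M = N ∸ 1
  c = K * r
  rotate : ∀ a b c → a * b * c ≡ a * c * b
  rotate = solve-∀
  powers : 17 ^ r * M ^ c ≤ 16 ^ r * N ^ c
  powers = subst₂ _≤_
    (trans (^-distribʳ-* 17 (M ^ K) r) (cong (17 ^ r *_) (^-*-assoc M K r)))
    (trans (^-distribʳ-* 16 (N ^ K) r) (cong (16 ^ r *_) (^-*-assoc N K r)))
    (^-monoˡ-≤ r (decay K))

-- Supplies the gap for Chebyshev's inequality: `y * J` points, each missed with probability p/W ≤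
-- b/a, have mean at most y J b/a, and the margin is `J`. Only a comparison of numerals is left.
scale-gap : ∀ a b y t J p W .{{_ : NonZero a}} → a * p ≤ b * W → y * b + a ≤ t * a →
  y * J * p + W * J ≤ W * (t * J)
scale-gap a b y t J p W ap≤bW numeric = *-cancelʳ-≤ _ _ a (begin
  (y * J * p + W * J) * a          ≡⟨ e₁ y J p W a ⟩
  y * J * (a * p) + W * J * a      ≤⟨ +-monoˡ-≤ _ (*-monoʳ-≤ (y * J) ap≤bW) ⟩
  y * J * (b * W) + W * J * a      ≡⟨ e₂ y J b W a ⟩
  W * J * (y * b + a)              ≤⟨ *-monoʳ-≤ (W * J) numeric ⟩
  W * J * (t * a)                  ≡⟨ e₃ W J t a ⟩
  W * (t * J) * a                  ∎)
  where
  open ≤-Reasoning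
  e₁ : ∀ y j p w a → (y * j * p + w * j) * a ≡ y * j * (a * p) + w * j * a
  e₁ = solve-∀
  e₂ : ∀ y j b w a → y * j * (b * w) + w * j * a ≡ w * j * (y * b + a)
  e₂ = solve-∀
  e₃ : ∀ w j t a → w * j * (t * a) ≡ w * (t * j) * a
  e₃ = solve-∀

module Occupancy {d n : ℕ} (X : Config d → Bool) where

  N = 2 ^ n
  all = functions d (configs n)
  W = length all
  p = confined d X N (N ∸ 1)
  q = confined d X N (N ∸ 2)

  avoids : Config n → Config d → Config n → ℕ
  avoids y x v = if X x then 𝟙 (¬? (v ≟ y)) else 1

  -- The indicator is written as a product over the arguments so that `∑-functions` yields its mean
  -- and the mixed moments.
  miss : (Config d → Config n) → Config n → ℕ
  miss f y = ∏ d (λ x → avoids y x (f x))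

  missed : List (Config n) → (Config d → Config n) → ℕ
  missed ys f = ∑ ys (miss f)

  miss≡0⇒hit : ∀ f y → miss f y ≡ 0 → ∃ λ x → X x ≡ true × f x ≡ y
  miss≡0⇒hit f y e with ∏≡0 d _ e
  ... | x , e₀ = x , hit (X x) refl e₀
    where
    hit : ∀ b → X x ≡ b → (if b then 𝟙 (¬? (f x ≟ y)) else 1) ≡ 0 → X x ≡ true × f x ≡ y
    hit true e e₀ with f x ≟ y
    ... | yes fx≡y = e , fx≡y

  -- The decision is a separate argument, which lets `pick-hit` split on it.
  pick′ : ∀ f y → Dec (miss f y ≡ 0) → Config d
  pick′ f y (yes e) = proj₁ (miss≡0⇒hit f y e)
  pick′ f y (no _)  = replicate d false

  -- A preimage of y in X under f; a junk value if there is none.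
  pick : (Config d → Config n) → Config n → Config d
  pick f y = pick′ f y (miss f y ℕ.≟ 0)

  pick-hit : ∀ f y → miss f y ≡ 0 → X (pick f y) ≡ true × f (pick f y) ≡ y
  pick-hit f y e = go (miss f y ℕ.≟ 0)
    where
    go : (e? : Dec (miss f y ≡ 0)) → X (pick′ f y e?) ≡ true × f (pick′ f y e?) ≡ y
    go (yes e₀) = proj₂ (miss≡0⇒hit f y e₀)
    go (no ¬e)  = contradiction e ¬e

  -- A point that is not hit contributes at least 1 to the sum. The map `e` allows points to be
  -- listed through an embedding such as `false ∷_`.
  length-hits : ∀ f (e : A → Config n) as →
    length as ≤ length (filter (λ a → miss f (e a) ℕ.≟ 0) as) + ∑ as (λ a → miss f (e a))
  length-hits f e as = begin
    length as                                             ≡⟨ ∑-𝟙-¬? miss≟0 as ⟨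
    ∑ as (λ a → 𝟙 (miss≟0 a)) + ∑ as (λ a → 𝟙 (¬? (miss≟0 a)))
      ≤⟨ +-mono-≤ (≤-reflexive (sym (length-filter-∑ miss≟0 as))) (∑-mono as (λ a → nonzero (miss≟0 a))) ⟩
    length (filter miss≟0 as) + ∑ as (λ a → miss f (e a)) ∎
    where
    open ≤-Reasoning
    miss≟0 : ∀ a → Dec (miss f (e a) ≡ 0)
    miss≟0 a = miss f (e a) ℕ.≟ 0
    nonzero : ∀ {m} (m≟0 : Dec (m ≡ 0)) → 𝟙 (¬? m≟0) ≤ m
    nonzero (yes _)  = z≤n
    nonzero (no m≢0) = n≢0⇒n>0 m≢0

  ∑-miss : ∀ y → ∑ all (λ f → miss f y) ≡ p
  ∑-miss y = trans (∑-functions d (configs n) (avoids y)) (∏-cong d (λ x → value (X x)))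
    where
    value : ∀ b → ∑ (configs n) (λ v → if b then 𝟙 (¬? (v ≟ y)) else 1) ≡ (if b then N ∸ 1 else N)
    value true  = ∑-≢ y
    value false = trans (∑-1 (configs n)) (length-configs n)

  -- For distinct points an argument in `X` has N - 2 admissible values, which gives `q`; for equal
  -- points the indicators are idempotent, which gives `p`. The uniform bound spends an extra `q` on
  -- the diagonal so that it sums easily.
  ∑-miss-product : ∀ y y′ → ∑ all (λ f → miss f y * miss f y′) ≤ q + 𝟙 (y′ ≟ y) * p
  ∑-miss-product y y′ = ≤-trans (≤-reflexive (trans
    (∑-cong all (λ f → sym (∏-* d _ _)))
    (∑-functions d (configs n) (λ x v → avoids y x v * avoids y′ x v)))) bound
    where
    both : ∀ b v → ℕ
    both b v = (if b then 𝟙 (¬? (v ≟ y)) else 1) * (if b then 𝟙 (¬? (v ≟ y′)) else 1)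

    same : y′ ≡ y → ∀ b → ∑ (configs n) (both b) ≡ (if b then N ∸ 1 else N)
    same refl false = trans (∑-1 (configs n)) (length-configs n)
    same refl true  = trans (∑-cong (configs n) (λ v → idempotent (¬? (v ≟ y)))) (∑-≢ y)
      where
      idempotent : ∀ {P : Set} (e : Dec P) → 𝟙 e * 𝟙 e ≡ 𝟙 e
      idempotent (yes _) = refl
      idempotent (no _)  = refl

    different : y′ ≢ y → ∀ b → ∑ (configs n) (both b) ≡ (if b then N ∸ 2 else N)
    different y′≢y false = trans (∑-1 (configs n)) (length-configs n)
    different y′≢y true  = ∑-≢₂ (≢-sym y′≢y)

    bound : ∏ d (λ x → ∑ (configs n) (both (X x))) ≤ q + 𝟙 (y′ ≟ y) * p
    bound with y′ ≟ y
    ... | yes e = ≤-trans (≤-reflexive (trans (∏-cong d (λ x → same e (X x))) (sym (*-identityˡ p)))) (m≤n+m _ q)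
    ... | no ¬e = ≤-trans (≤-reflexive (∏-cong d (λ x → different ¬e (X x)))) (m≤m+n q 0)

  W≡ : W ≡ N ^ (2 ^ d)
  W≡ = trans (length-functions d (configs n)) (cong (_^ (2 ^ d)) (length-configs n))

  instance
    W≢0 : NonZero W
    W≢0 = subst NonZero (sym W≡) (m^n≢0 N (2 ^ d) {{m^n≢0 2 n}})

  -- Negative correlation of the missed events: the inequality for a single value, multiplied over
  -- all arguments.
  Wq≤p² : W * q ≤ p * p
  Wq≤p² = subst₂ _≤_
    (trans (∏-* d _ _) (cong (_* q) (trans (∏-const d N) (sym W≡)))) (∏-* d _ _)
    (∏-mono d (λ x → factor (X x)))
    where
    factor : ∀ b → N * (if b then N ∸ 2 else N) ≤ (if b then N ∸ 1 else N) * (if b then N ∸ 1 else N)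
    factor true  = N[N-2]≤[N-1]² N
    factor false = ≤-refl

  p-decay : ∀ K r .{{_ : NonZero K}} → N ≡ 16 * K → card X ≡ K * r → 17 ^ r * p ≤ 16 ^ r * W
  p-decay K r N≡ card≡ = subst (λ w → 17 ^ r * p ≤ 16 ^ r * w) (sym W≡)
    (subst (λ N → 17 ^ r * confined d X N (N ∸ 1) ≤ 16 ^ r * N ^ (2 ^ d)) (sym N≡)
      (confined-decay d X K r card≡))

  ∑-missed : ∀ ys → ∑ all (missed ys) ≡ length ys * p
  ∑-missed ys = trans (∑-swap all ys miss) (trans (∑-cong ys ∑-miss) (∑-const ys p))

  -- The variance is at most the mean: the l² terms `q` are absorbed by the squared mean through
  -- `Wq≤p²`, and the diagonal terms `p` add up to at most the mean.
  ∑-missed² : ∀ ys → Unique ys →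
    W * ∑ all (λ f → missed ys f * missed ys f) ≤ ∑ all (missed ys) * ∑ all (missed ys) + W * ∑ all (missed ys)
  ∑-missed² ys uys = begin
    W * ∑ all (λ f → missed ys f * missed ys f)
      ≡⟨ cong (W *_) (∑-cong all (λ f → ∑-product ys ys (miss f) (miss f))) ⟨
    W * ∑ all (λ f → ∑ ys λ y → ∑ ys λ y′ → miss f y * miss f y′)
      ≡⟨ cong (W *_) (trans (∑-swap all ys _) (∑-cong ys (λ y → ∑-swap all ys _))) ⟩
    W * (∑ ys λ y → ∑ ys λ y′ → ∑ all λ f → miss f y * miss f y′)
      ≤⟨ *-monoʳ-≤ W (∑-mono ys row) ⟩
    W * ∑ ys (λ _ → l * q + p)               ≡⟨ cong (W *_) (∑-const ys _) ⟩
    W * (l * (l * q + p))                    ≡⟨ regroup W l q p ⟩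
    l * l * (W * q) + W * (l * p)            ≤⟨ +-monoˡ-≤ _ (*-monoʳ-≤ (l * l) Wq≤p²) ⟩
    l * l * (p * p) + W * (l * p)            ≡⟨ cong (_+ W * (l * p)) ([m*n]*[o*p]≡[m*o]*[n*p] l l p p) ⟩
    l * p * (l * p) + W * (l * p)            ≡⟨ cong (λ t → t * t + W * t) (∑-missed ys) ⟨
    ∑ all (missed ys) * ∑ all (missed ys) + W * ∑ all (missed ys) ∎
    where
    open ≤-Reasoning
    l = length ys
    regroup : ∀ w l q p → w * (l * (l * q + p)) ≡ l * l * (w * q) + w * (l * p)
    regroup = solve-∀
    row : ∀ y → (∑ ys λ y′ → ∑ all λ f → miss f y * miss f y′) ≤ l * q + p
    row y = begin
      (∑ ys λ y′ → ∑ all λ f → miss f y * miss f y′)      ≤⟨ ∑-mono ys (∑-miss-product y) ⟩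
      ∑ ys (λ y′ → q + 𝟙 (y′ ≟ y) * p)                    ≡⟨ ∑-+ ys _ _ ⟩
      ∑ ys (λ _ → q) + ∑ ys (λ y′ → 𝟙 (y′ ≟ y) * p)       ≡⟨ cong₂ _+_ (∑-const ys q) (∑-*ʳ ys p _) ⟩
      l * q + ∑ ys (λ y′ → 𝟙 (y′ ≟ y)) * p                ≤⟨ +-monoʳ-≤ (l * q) (*-monoˡ-≤ p (∑-≟-unique uys y)) ⟩
      l * q + 1 * p                                       ≡⟨ cong (l * q +_) (*-identityˡ p) ⟩
      l * q + p                                           ∎

  missed-concentration : ∀ ys → Unique ys → ∀ s t → length ys * p + W * s ≤ W * t →
    ∑ all (λ f → 𝟙 (t ≤? missed ys f)) * (s * s) ≤ W * t
  missed-concentration ys uys s t gap = chebyshev all (missed ys) s t (∑-missed² ys uys)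
    (subst (λ m → m + W * s ≤ W * t) (sym (∑-missed ys)) gap)

-- Exposing a random function in two rounds

_∈?_ : ∀ {n} (v : Config n) (L : List (Config n)) → Dec (v ∈ L)
_∈?_ = DecMembership._∈?_ _≟_

does-∈? : ∀ {n} {v : Config n} (L : List (Config n)) → does (v ∈? L) ≡ true → v ∈ L
does-∈? {v = v} L e with v ∈? L
... | yes v∈ = v∈

-- Repetitions only lower the count. This upper bound serves `reserved`; the exact count for unique
-- lists below serves `middles`.
∑-∈ : ∀ {n} (L : List (Config n)) → ∑ (configs n) (λ v → 𝟙 (v ∈? L)) ≤ length L
∑-∈ {n} []      = ≤-reflexive (trans (∑-const (configs n) 0) (*-zeroʳ (length (configs n))))
∑-∈ {n} (l ∷ L) = begin
  ∑ (configs n) (λ v → 𝟙 (v ∈? (l ∷ L)))                         ≤⟨ ∑-mono (configs n) pointwise ⟩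
  ∑ (configs n) (λ v → 𝟙 (v ≟ l) + 𝟙 (v ∈? L))                   ≡⟨ ∑-+ (configs n) _ _ ⟩
  ∑ (configs n) (λ v → 𝟙 (v ≟ l)) + ∑ (configs n) (λ v → 𝟙 (v ∈? L)) ≤⟨ +-mono-≤ (≤-reflexive (∑-≟ l)) (∑-∈ L) ⟩
  suc (length L)                                                ∎
  where
  open ≤-Reasoning
  pointwise : ∀ v → 𝟙 (v ∈? (l ∷ L)) ≤ 𝟙 (v ≟ l) + 𝟙 (v ∈? L)
  pointwise v with v ≟ l | v ∈? L
  ... | yes _ | _     = s≤s z≤n
  ... | no _  | yes _ = ≤-refl
  ... | no _  | no _  = ≤-refl

∑-∈-unique : ∀ {n} {L : List (Config n)} → Unique L → ∑ (configs n) (λ v → 𝟙 (v ∈? L)) ≡ length L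
∑-∈-unique {n} [] = trans (∑-const (configs n) 0) (*-zeroʳ (length (configs n)))
∑-∈-unique {n} {l ∷ L} (l∉ ∷ uL) = begin
  ∑ (configs n) (λ v → 𝟙 (v ∈? (l ∷ L)))                         ≡⟨ ∑-cong (configs n) pointwise ⟩
  ∑ (configs n) (λ v → 𝟙 (v ≟ l) + 𝟙 (v ∈? L))                   ≡⟨ ∑-+ (configs n) _ _ ⟩
  ∑ (configs n) (λ v → 𝟙 (v ≟ l)) + ∑ (configs n) (λ v → 𝟙 (v ∈? L)) ≡⟨ cong₂ _+_ (∑-≟ l) (∑-∈-unique uL) ⟩
  suc (length L)                                                ∎
  where
  open ≡-Reasoning
  pointwise : ∀ v → 𝟙 (v ∈? (l ∷ L)) ≡ 𝟙 (v ≟ l) + 𝟙 (v ∈? L)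
  pointwise v with v ≟ l | v ∈? L
  ... | yes refl | yes l∈ = contradiction refl (All.lookup l∉ l∈)
  ... | yes _    | no _   = refl
  ... | no _     | yes _  = refl
  ... | no _     | no _   = refl

length-take-≥ : ∀ {A : Set} k {xs : List A} → k ≤ length xs → length (take k xs) ≡ k
length-take-≥ k {xs} k≤ = trans (length-take k xs) (m≤n⇒m⊓n≡m k≤)

-- All quantities are multiples of J: there are 256 J configurations, of which the 128 J with first bit
-- true have their values exposed first, and the 128 J with first bit false second.
module Exposure (m J : ℕ) {{_ : NonZero J}} (2^m≡ : 2 ^ m ≡ 32 * J) where

  d = 2 + m
  n = 3 + m

  instance
    16J≢0 : NonZero (16 * J)
    16J≢0 = m*n≢0 16 J

  2^d≡ : 2 ^ d ≡ 128 * J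
  2^d≡ = trans (^-distribˡ-+-* 2 2 m) (trans (cong (4 *_) 2^m≡) (sym (*-assoc 4 32 J)))

  2^n≡ : 2 ^ n ≡ 256 * J
  2^n≡ = trans (^-distribˡ-+-* 2 3 m) (trans (cong (8 *_) 2^m≡) (sym (*-assoc 8 32 J)))

  2^n≡16K : 2 ^ n ≡ 16 * (16 * J)
  2^n≡16K = trans 2^n≡ (*-assoc 16 16 J)

  module First = Occupancy {d} {n} (λ _ → true)

  W = First.W

  targets : List (Config n)
  targets = map (false ∷_) (configs d)

  targets-unique : Unique targets
  targets-unique = AllPairs.map⁺ (AllPairs.map (λ x≢y e → x≢y (Vec.∷-injectiveʳ e)) (configs-unique d))

  length-targets : length targets ≡ 128 * J
  length-targets = trans (length-map _ (configs d)) (trans (length-configs d) 2^d≡)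

  -- An entry `x` stands for `false ∷ x`. The cut at 48 J, which is 3N/16, makes the number of
  -- arguments exposed in the second round exactly three times 16 J when enough targets are hit.
  middles : (Config d → Config n) → List (Config d)
  middles g = take (48 * J) (filter (λ x → First.miss g (false ∷ x) ℕ.≟ 0) (configs d))

  reserved : (Config d → Config n) → List (Config n)
  reserved g = map (false ∷_) (middles g) ++ map (λ x → true ∷ First.pick g (false ∷ x)) (middles g)

  -- This depends on the first half `g` alone, so the second half is still uniform when hits on
  -- these points are counted. The cut at 160 J, which is 5N/8, fixes the length for every `g`.
  ends : (Config d → Config n) → List (Config n)
  ends g = take (160 * J) (filter (λ v → ¬? (v ∈? reserved g)) (configs n))

  module Second (g : Config d → Config n) = Occupancy {d} {n} (λ x → does (x ∈? middles g))

  middles-unique : ∀ g → Unique (middles g)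
  middles-unique g = AllPairs.take⁺ (48 * J) (AllPairs.filter⁺ _ (configs-unique d))

  middles-hit : ∀ g → All (λ x → First.miss g (false ∷ x) ≡ 0) (middles g)
  middles-hit g = All.take⁺ (48 * J) (All.all-filter _ (configs d))

  ends-unique : ∀ g → Unique (ends g)
  ends-unique g = AllPairs.take⁺ (160 * J) (AllPairs.filter⁺ _ (configs-unique n))

  ends-free : ∀ g → All (_∉ reserved g) (ends g)
  ends-free g = All.take⁺ (160 * J) (All.all-filter _ (configs n))

  length-middles : ∀ g → First.missed targets g < 80 * J → length (middles g) ≡ 48 * J
  length-middles g few = length-take-≥ (48 * J) (+-cancelʳ-≤ (80 * J) _ _ (begin
    48 * J + 80 * J                       ≡⟨ *-distribʳ-+ J 48 80 ⟨
    128 * J                               ≡⟨ trans (length-configs d) 2^d≡ ⟨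
    length (configs d)                    ≤⟨ First.length-hits g (false ∷_) (configs d) ⟩
    length hit + ∑ (configs d) (λ x → First.miss g (false ∷ x))
      ≡⟨ cong (length hit +_) (∑-map (false ∷_) (configs d) (First.miss g)) ⟨
    length hit + First.missed targets g   ≤⟨ +-monoʳ-≤ (length hit) (<⇒≤ few) ⟩
    length hit + 80 * J                   ∎))
    where
    open ≤-Reasoning
    hit = filter (λ x → First.miss g (false ∷ x) ℕ.≟ 0) (configs d)

  length-reserved : ∀ g → length (reserved g) ≤ 96 * J
  length-reserved g = begin
    length (reserved g)                     ≡⟨ length-++ (map (false ∷_) (middles g)) {map chosen (middles g)} ⟩
    length (map (false ∷_) (middles g)) + length (map chosen (middles g))
      ≡⟨ cong₂ _+_ (length-map (false ∷_) (middles g)) (length-map chosen (middles g)) ⟩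
    length (middles g) + length (middles g) ≤⟨ +-mono-≤ few few ⟩
    48 * J + 48 * J                         ≡⟨ *-distribʳ-+ J 48 48 ⟨
    96 * J                                  ∎
    where
    open ≤-Reasoning
    chosen : Config d → Config n
    chosen x = true ∷ First.pick g (false ∷ x)
    few : length (middles g) ≤ 48 * J
    few = ≤-trans (≤-reflexive (length-take (48 * J) (filter _ (configs d)))) (m⊓n≤m (48 * J) _)

  length-ends : ∀ g → length (ends g) ≡ 160 * J
  length-ends g = length-take-≥ (160 * J) (+-cancelˡ-≤ (96 * J) _ _ (begin
    96 * J + 160 * J                      ≡⟨ *-distribʳ-+ J 96 160 ⟨
    256 * J                               ≡⟨ trans (length-configs n) 2^n≡ ⟨
    length (configs n)                    ≡⟨ ∑-𝟙-¬? (_∈? reserved g) (configs n) ⟨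
    ∑ (configs n) (λ v → 𝟙 (v ∈? reserved g)) + ∑ (configs n) (λ v → 𝟙 (¬? (v ∈? reserved g)))
      ≤⟨ +-mono-≤ (≤-trans (∑-∈ (reserved g)) (length-reserved g))
                  (≤-reflexive (sym (length-filter-∑ (λ v → ¬? (v ∈? reserved g)) (configs n)))) ⟩
    96 * J + length (filter (λ v → ¬? (v ∈? reserved g)) (configs n)) ∎))
    where open ≤-Reasoning

  -- A decidable condition, so that the functions satisfying it can be filtered from the
  -- enumeration. Missing fewer than 80 J of the 128 J targets leaves 48 J middles; missing fewer
  -- than 136 J of the 160 J ends leaves 24 J chains.
  Few : Fn n → Set
  Few f = First.missed targets (f ∘ (true ∷_)) < 80 * J ×
    Second.missed (f ∘ (true ∷_)) (ends (f ∘ (true ∷_))) (f ∘ (false ∷_)) < 136 * J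

  few? : ∀ f → Dec (Few f)
  few? f = (_ <? _) ×-dec (_ <? _)

  few⇒Good : ∀ f → Few f → Good f
  -- Two chains per cell turn 24 J chains into 12 J cells. Starts and middles already differ in the
  -- first bit.
  few⇒Good f (_ , few) = Packing.chains⇒Good f (_∈ reserved g) a x (λ _ _ ()) (12 * J)
    (configs-unique m) (AllPairs.filter⁺ _ (ends-unique g)) chains enough-cells enough-chains count
    where
    g = f ∘ (true ∷_)
    h = f ∘ (false ∷_)
    x a : Config n → Config n
    -- An end is traced back twice: to a middle through the second round, then to a start through
    -- the first.
    x c = false ∷ Second.pick g h c
    a c = true ∷ First.pick g (x c)

    hit? : ∀ c → Dec (Second.miss g h c ≡ 0)
    hit? c = Second.miss g h c ℕ.≟ 0

    cs = filter hit? (ends g)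

    chain : ∀ {c} → Second.miss g h c ≡ 0 × c ∉ reserved g → Chain f (_∈ reserved g) a x c
    chain {c} (hit , free) = record
      { fa≡x = proj₂ (First.pick-hit g (x c) (All.lookup (middles-hit g) middle))
      ; fx≡c = proj₂ (Second.pick-hit g h c hit)
      ; a∈S  = ∈-++⁺ʳ (map (false ∷_) (middles g)) (∈-map⁺ (λ x → true ∷ First.pick g (false ∷ x)) middle)
      ; x∈S  = ∈-++⁺ˡ (∈-map⁺ (false ∷_) middle)
      ; c∉S  = free
      }
      where
      middle : Second.pick g h c ∈ middles g
      middle = does-∈? (middles g) (proj₁ (Second.pick-hit g h c hit))

    chains : All (Chain f (_∈ reserved g) a x) cs
    chains = All.map chain (All.zip (All.all-filter hit? (ends g) , All.filter⁺ hit? (ends-free g)))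

    enough-cells : 12 * J ≤ length (configs m)
    enough-cells = ≤-trans (*-monoˡ-≤ J (≤ᵇ⇒≤ 12 32 tt))
      (≤-reflexive (sym (trans (length-configs m) 2^m≡)))

    enough-chains : 12 * J * 2 ≤ length cs
    enough-chains = +-cancelʳ-≤ (136 * J) _ _ (begin
      12 * J * 2 + 136 * J      ≡⟨ cong (_+ 136 * J) (trans (*-comm (12 * J) 2) (sym (*-assoc 2 12 J))) ⟩
      24 * J + 136 * J          ≡⟨ *-distribʳ-+ J 24 136 ⟨
      160 * J                   ≡⟨ length-ends g ⟨
      length (ends g)           ≤⟨ Second.length-hits g h id (ends g) ⟩
      length cs + Second.missed g (ends g) h ≤⟨ +-monoʳ-≤ (length cs) (<⇒≤ few) ⟩
      length cs + 136 * J       ∎)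
      where open ≤-Reasoning

    count : 46 * 2 ^ n ≤ 1000 * (12 * J)
    count = begin
      46 * 2 ^ n                ≡⟨ trans (cong (46 *_) 2^n≡) (sym (*-assoc 46 256 J)) ⟩
      -- The density 12/256 = 0.046875 lies just above 0.046.
      46 * 256 * J              ≤⟨ *-monoˡ-≤ J (≤ᵇ⇒≤ (46 * 256) (1000 * 12) tt) ⟩
      1000 * 12 * J             ≡⟨ *-assoc 1000 12 J ⟩
      1000 * (12 * J)           ∎
      where open ≤-Reasoning

  -- Counting the exceptional functions.

  cancel-J : ∀ b w t → b * (J * J) ≤ w * (t * J) → b * J ≤ w * t
  cancel-J b w t le = *-cancelʳ-≤ _ _ J (subst₂ _≤_ (sym (*-assoc b J J)) (sym (*-assoc w t J)) le)

  first-bad : (Config d → Config n) → ℕ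
  first-bad g = 𝟙 (80 * J ≤? First.missed targets g)

  second-bad : (g h : Config d → Config n) → ℕ
  second-bad g h = 𝟙 (136 * J ≤? Second.missed g (ends g) h)

  first-bound : ∑ First.all first-bad * J ≤ W * 80
  first-bound = cancel-J (∑ First.all first-bad) W 80 (First.missed-concentration targets targets-unique J (80 * J)
    (subst (λ l → l * First.p + W * J ≤ W * (80 * J)) (sym length-targets)
      -- The 128 J exposed arguments are 8 times 16 J, hence the exponent. The mean is at most 128
      -- (16/17) ^ 8 J, about 78.8 J, so a margin of J fits below 80 J.
      (scale-gap (17 ^ 8) (16 ^ 8) 128 80 J First.p W
        (First.p-decay (16 * J) 8 2^n≡16K card≡)
        (≤ᵇ⇒≤ (128 * 16 ^ 8 + 17 ^ 8) (80 * 17 ^ 8) tt))))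
    where
    card≡ : card {d} (λ _ → true) ≡ 16 * J * 8
    card≡ = trans (∑-1 (configs d)) (trans (length-configs d)
      (trans 2^d≡ (trans (*-assoc 8 16 J) (*-comm 8 (16 * J)))))

  second-bound : ∀ g → First.missed targets g < 80 * J → ∑ First.all (second-bad g) * J ≤ W * 136
  second-bound g few = cancel-J (∑ First.all (second-bad g)) W 136 (Second.missed-concentration g (ends g) (ends-unique g) J (136 * J)
    (subst (λ l → l * Second.p g + W * J ≤ W * (136 * J)) (sym (length-ends g))
      -- The 48 J middles give the exponent 3, and 160 (16/17) ^ 3 is about 133.4, which leaves the
      -- margin 1 below 136.
      (scale-gap (17 ^ 3) (16 ^ 3) 160 136 J (Second.p g) W
        (Second.p-decay g (16 * J) 3 2^n≡16K card≡)
        (≤ᵇ⇒≤ (160 * 16 ^ 3 + 17 ^ 3) (136 * 17 ^ 3) tt))))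
    where
    card≡ : card (λ x → does (x ∈? middles g)) ≡ 16 * J * 3
    card≡ = trans (∑-∈-unique (middles-unique g)) (trans (length-middles g few)
      (trans (*-assoc 3 16 J) (*-comm 3 (16 * J))))

  bad : Fn n → ℕ
  bad f = 𝟙 (¬? (few? f))

  -- For an exceptional `g` all continuations are given up. Otherwise `join g h` can fail only in
  -- the second round, because its half with first bit true is `g` itself.
  bad-row : ∀ g → ∑ First.all (λ h → bad (join g h)) * J ≤ first-bad g * (W * J) + W * 136
  bad-row g with <-≤-connex (First.missed targets g) (80 * J)
  ... | inj₂ many = begin
    ∑ First.all (λ h → bad (join g h)) * J  ≤⟨ *-monoˡ-≤ J (∑-mono First.all (λ h → 𝟙≤1 (¬? (few? (join g h))))) ⟩
    ∑ First.all (λ _ → 1) * J               ≡⟨ cong (_* J) (∑-1 First.all) ⟩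
    W * J                                   ≡⟨ *-identityˡ (W * J) ⟨
    1 * (W * J)                             ≡⟨ cong (_* (W * J)) (𝟙-yes (80 * J ≤? First.missed targets g) many) ⟨
    first-bad g * (W * J)                   ≤⟨ m≤m+n _ _ ⟩
    first-bad g * (W * J) + W * 136         ∎
    where open ≤-Reasoning
  ... | inj₁ few = begin
    ∑ First.all (λ h → bad (join g h)) * J  ≤⟨ *-monoˡ-≤ J (∑-mono First.all pointwise) ⟩
    ∑ First.all (second-bad g) * J          ≤⟨ second-bound g few ⟩
    W * 136                                 ≤⟨ m≤n+m _ _ ⟩
    first-bad g * (W * J) + W * 136         ∎
    where
    open ≤-Reasoning
    pointwise : ∀ h → bad (join g h) ≤ second-bad g h
    pointwise h with <-≤-connex (Second.missed g (ends g) h) (136 * J)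
    ... | inj₁ few′ = ≤-trans (≤-reflexive (𝟙-no (¬? (few? (join g h))) (λ ¬few → ¬few (few , few′)))) z≤n
    ... | inj₂ many = ≤-trans (𝟙≤1 (¬? (few? (join g h)))) (≤-reflexive (sym (𝟙-yes (136 * J ≤? _) many)))

  everything : List (Fn n)
  everything = functions n (configs n)

  length-everything : length everything ≡ W * W
  length-everything = begin
    length everything                    ≡⟨ ∑-1 everything ⟨
    ∑ everything (λ _ → 1)               ≡⟨ ∑-cartesian join First.all First.all _ ⟩
    (∑ First.all λ _ → ∑ First.all λ _ → 1) ≡⟨ ∑-const First.all _ ⟩
    W * ∑ First.all (λ _ → 1)            ≡⟨ cong (W *_) (∑-1 First.all) ⟩
    W * W                                ∎
    where open ≡-Reasoning

  -- The failure probabilities of the two rounds, at most 80/J and 136/J, add up to 216/J.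
  bad-bound : ∑ everything bad * J ≤ length everything * 216
  bad-bound = begin
    ∑ everything bad * J                                        ≡⟨ cong (_* J) (∑-cartesian join First.all First.all bad) ⟩
    (∑ First.all λ g → ∑ First.all λ h → bad (join g h)) * J    ≡⟨ ∑-*ʳ First.all J _ ⟨
    (∑ First.all λ g → (∑ First.all λ h → bad (join g h)) * J)  ≤⟨ ∑-mono First.all bad-row ⟩
    ∑ First.all (λ g → first-bad g * (W * J) + W * 136)         ≡⟨ ∑-+ First.all _ _ ⟩
    ∑ First.all (λ g → first-bad g * (W * J)) + ∑ First.all (λ _ → W * 136)
      ≡⟨ cong₂ _+_ (∑-*ʳ First.all (W * J) first-bad) (∑-const First.all (W * 136)) ⟩
    ∑ First.all first-bad * (W * J) + W * (W * 136)             ≡⟨ cong (_+ W * (W * 136)) (rotate (∑ First.all first-bad) W J) ⟩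
    W * (∑ First.all first-bad * J) + W * (W * 136)             ≤⟨ +-monoˡ-≤ _ (*-monoʳ-≤ W first-bound) ⟩
    W * (W * 80) + W * (W * 136)                                ≡⟨ cong₂ _+_ (*-assoc W W 80) (*-assoc W W 136) ⟨
    W * W * 80 + W * W * 136                                    ≡⟨ *-distribˡ-+ (W * W) 80 136 ⟨
    W * W * 216                                                 ≡⟨ cong (_* 216) length-everything ⟨
    length everything * 216                                     ∎
    where
    open ≤-Reasoning
    rotate : ∀ b w j → b * (w * j) ≡ w * (b * j)
    rotate = solve-∀

  good : List (Fn n)
  good = filter few? everything

  good+bad : length good + ∑ everything bad ≡ length everything
  good+bad = trans (cong (_+ ∑ everything bad) (length-filter-∑ few? everything)) (∑-𝟙-¬? few? everything)

  length-good : ∀ k → suc k * 216 ≤ J → k * length everything ≤ suc k * length good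
  length-good k large = +-cancelʳ-≤ (length everything) _ _ (begin
    k * length everything + length everything          ≡⟨ +-comm (k * length everything) _ ⟩
    suc k * length everything                          ≡⟨ cong (suc k *_) good+bad ⟨
    suc k * (length good + ∑ everything bad)           ≡⟨ *-distribˡ-+ (suc k) (length good) _ ⟩
    suc k * length good + suc k * ∑ everything bad     ≤⟨ +-monoʳ-≤ (suc k * length good) rare ⟩
    suc k * length good + length everything            ∎)
    where
    open ≤-Reasoning
    rotate : ∀ k b c → k * b * c ≡ b * (k * c)
    rotate = solve-∀
    rare : suc k * ∑ everything bad ≤ length everything
    rare = *-cancelʳ-≤ _ _ 216 (begin
      suc k * ∑ everything bad * 216     ≡⟨ rotate (suc k) (∑ everything bad) 216 ⟩
      ∑ everything bad * (suc k * 216)   ≤⟨ *-monoʳ-≤ (∑ everything bad) large ⟩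
      ∑ everything bad * J               ≤⟨ bad-bound ⟩
      length everything * 216            ∎)

  length-everything≡cardF : length everything ≡ cardF n
  length-everything≡cardF = trans (length-functions n (configs n)) (cong (_^ (2 ^ n)) (length-configs n))

  mostly-Good : ∀ k → suc k * 216 ≤ J →
    Σ (List (Fn n)) λ fs → AllPairs DistinctFns fs × All Good fs × (k * cardF n ≤ suc k * length fs)
  mostly-Good k large =
    good ,
    AllPairs.filter⁺ few? (functions-distinct n (configs-unique n)) ,
    All.map (λ {f} → few⇒Good f) (All.all-filter few? everything) ,
    subst (λ c → k * c ≤ suc k * length good) length-everything≡cardF (length-good k large)

-- Passage to the limit.

n≤2^n : ∀ n → n ≤ 2 ^ n
n≤2^n zero    = z≤n
n≤2^n (suc n) = ≤-trans (+-mono-≤ (m^n>0 2 n) (n≤2^n n)) (+-monoʳ-≤ (2 ^ n) (m≤m+n (2 ^ n) 0))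

-- Convergence to 1 is tested on the proportions k/(k+1). A list of pairwise distinct functions
-- bounds the number of `Good` ones from below.
theorem4 : (k : ℕ) → Σ ℕ λ N → (n : ℕ) → N ≤ n →
    Σ (List (Fn n)) λ fs →
    AllPairs DistinctFns fs × All Good fs ×
    (k * cardF n ≤ suc k * length fs)
theorem4 k = 8 + suc k * 216 , λ n large →
  shifted n (m≤n⇒∃[o]m+o≡n (≤-trans (m≤m+n 8 (suc k * 216)) large)) large
  where
  shifted : ∀ n → (∃ λ j → 8 + j ≡ n) → 8 + suc k * 216 ≤ n →
    Σ (List (Fn n)) λ fs → AllPairs DistinctFns fs × All Good fs × (k * cardF n ≤ suc k * length fs)
  shifted _ (j , refl) large =
    -- With n = 8 + j, the unit is J = 2 ^ j because 2 ^ (5 + j) = 32 J. The crude bound j ≤ 2 ^ j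
    -- then makes J at least 216 (k + 1).
    Exposure.mostly-Good (5 + j) (2 ^ j) {{m^n≢0 2 j}} (^-distribˡ-+-* 2 5 j) k
      (≤-trans (+-cancelˡ-≤ 8 (suc k * 216) j large) (n≤2^n j))
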